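{- \[ \liminf_{n\to \infty} \frac{\sigma^*(\phi^*(n))}{n} \le \inf \left\{\frac{\sigma^*(\phi^*(m/2))}{m/2} : m \text{ a positive even integer},\ m\ne 2^{\ell} \text{ for every integer } \ell \ge 2 \right\}, \] and \[ \liminf_{n\to \infty} \frac{\sigma^*(\phi^*(n))}{n} \le \frac14 + \varepsilon, \qquad \text{where } \varepsilon = \frac{3}{4(2^{32}-1)}. \]
   Context: For $n=p_1^{a_1}\cdots p_r^{a_r}$ the prime factorization of $n>1$, $\sigma^*(n)=(p_1^{a_1}+1)\cdots(p_r^{a_r}+1)$ is the sum of unitary divisors of $n$ (divisors $d$ with $\gcd(d,n/d)=1$) and $\phi^*(n)=(p_1^{a_1}-1)\cdots(p_r^{a_r}-1)$ is the unitary Euler function; $\sigma^*(1)=\phi^*(1)=1$. -}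

module Defs where

open import Data.Nat using (ℕ; zero; suc; _+_; _*_; _∸_; _^_)
open import Data.Nat.Divisibility using (_∣_; _∣?_; divides)
open import Data.Nat.Primality using (prime?)
open import Data.List using (List; map; filter; upTo)
open import Data.Nat.ListAction using (product)
open import Relation.Nullary using (yes; no; _×-dec_)
open import Data.Integer using (+_)
open import Data.Rational using (ℚ; _/_) renaming (0ℚ to 0q)

-- multiplicity of p in n, computed with fuel (fuel = n suffices for p ≥ 2, n ≥ 1)
valF : ℕ → ℕ → ℕ → ℕ
valF zero    p n = 0
valF (suc f) p zero = 0
valF (suc f) p (suc n) with p ∣? suc n
... | yes (divides q _) = suc (valF f p q)
... | no _ = 0

val : ℕ → ℕ → ℕ
val p n = valF n p n

primeDivisors : ℕ → List ℕ
primeDivisors n = filter (λ p → prime? p ×-dec p ∣? n) (upTo (suc n))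

primePowerParts : ℕ → List ℕ
primePowerParts n = map (λ p → p ^ val p n) (primeDivisors n)

σ* : ℕ → ℕ
σ* n = product (map (λ q → q + 1) (primePowerParts n))

φ* : ℕ → ℕ
φ* n = product (map (λ q → q ∸ 1) (primePowerParts n))

-- the ratio σ*(φ*(n)) / n as a rational (only used for n ≥ 1)
ratio : ℕ → ℚ
ratio zero = 0q
ratio (suc k) = (+ σ* (φ* (suc k))) / suc k

ε : ℚ
ε = (+ 3) / (4 * (2 ^ 32 ∸ 1))

{-# OPTIONS --safe #-}
module Submission where

-- The ratio ρ(n) = σ*(φ*(n)) / n satisfies ρ(kP) ≤ ρ(k) σ*(B) / P for P a product of distinct
-- primes q not dividing k and B = ∏ (q - 1), because σ* is submultiplicative and φ*
-- multiplicative. So it suffices to find such q, arbitrarily large, with σ*(B) / B close to 1,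
-- i.e. with ∏ (1 + p^(-v_p(B))) over the primes p | B close to 1. By Chebyshev's lower bound and
-- the pigeonhole principle, there are m primes q ≤ 2^(4y+2) whose q - 1 have exactly the same
-- divisors ≤ y. A prime p ≤ y dividing B then divides it to the power at least m, and the primes
-- p > y dividing B number at most log B / log y, which is o(y) for fixed m. For the constant
-- 1/4 + ε take k = 2 (2³² - 1), twice a product of Fermat primes, so that φ*(k) = 2³¹.

open import Defs

module UnitaryDivisors where

  open import Data.Nat
  open import Data.Nat.Properties
  open import Data.Nat.Divisibility
  open import Data.Nat.Primality
  open import Data.Nat.Primality.Factorisation using (PrimeFactorisation; factorise)
  open import Data.Nat.ListAction using (product)
  open import Data.Nat.ListAction.Properties using (product-++)
  open import Data.Nat.Tactic.RingSolver using (solve-∀)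
  open import Data.List using (List; []; _∷_; _++_; [_]; map; filter; upTo; length; take)
  open import Data.List.Properties
    using (upTo-∷ʳ; filter-++; filter-accept; map-++; map-∘; length-++; length-filter; length-upTo; length-take; length-map)
  open import Data.List.Relation.Unary.All as All using (All; []; _∷_)
  import Data.List.Relation.Unary.All.Properties as All
  open import Data.List.Relation.Unary.Unique.Propositional using (Unique; []; _∷_)
  import Data.List.Relation.Unary.Unique.Propositional.Properties as Unique
  open import Data.List.Relation.Unary.Unique.DecPropositional _≟_ using (unique?)
  open import Data.Product using (_×_; _,_; proj₁; proj₂; ∃-syntax)
  open import Data.Sum as Sum using (_⊎_; inj₁; inj₂; [_,_]′)
  open import Function using (_∘_)
  open import Relation.Nullary using (Dec; ¬_; yes; no; contradiction; _×-dec_; ¬?)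
  open import Relation.Nullary.Decidable using (from-yes)
  open import Relation.Binary.PropositionalEquality hiding ([_])

  -- Finite products over initial segments of the natural numbers.

  Π : ℕ → (ℕ → ℕ) → ℕ
  Π zero    f = 1
  Π (suc b) f = Π b f * f b

  Π-mono : ∀ b {f g} → (∀ i → f i ≤ g i) → Π b f ≤ Π b g
  Π-mono zero    e = ≤-refl
  Π-mono (suc b) e = *-mono-≤ (Π-mono b e) (e b)

  Π-pres-∣ : ∀ b {f g} → (∀ i → f i ∣ g i) → Π b f ∣ Π b g
  Π-pres-∣ zero    e = ∣-refl
  Π-pres-∣ (suc b) e = *-pres-∣ (Π-pres-∣ b e) (e b)

  Π-* : ∀ b f g → Π b (λ i → f i * g i) ≡ Π b f * Π b g
  Π-* zero    f g = refl
  Π-* (suc b) f g = trans (cong (_* (f b * g b)) (Π-* b f g)) (interchange (Π b f) (Π b g) (f b) (g b))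
    where
    interchange : ∀ x y u v → x * y * (u * v) ≡ x * u * (y * v)
    interchange = solve-∀

  Π≡1 : ∀ b {f} → (∀ i → f i ≡ 1) → Π b f ≡ 1
  Π≡1 zero    e = refl
  Π≡1 (suc b) e = cong₂ _*_ (Π≡1 b e) (e b)

  Π-pos : ∀ b {f} → (∀ i → 0 < f i) → 0 < Π b f
  Π-pos zero    e = s≤s z≤n
  Π-pos (suc b) e = *-mono-≤ (Π-pos b e) (e b)

  Π-extend : ∀ b d {f} → (∀ i → b ≤ i → f i ≡ 1) → Π (d + b) f ≡ Π b f
  Π-extend b zero    e = refl
  Π-extend b (suc d) e =
    trans (cong₂ _*_ (Π-extend b d e) (e (d + b) (m≤n+m b d))) (*-identityʳ _)

  Π-update-outside : ∀ b q {f g} → (∀ i → i ≢ q → f i ≡ g i) → b ≤ q → Π b f ≡ Π b g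
  Π-update-outside zero    q e b≤q = refl
  Π-update-outside (suc b) q e b<q =
    cong₂ _*_ (Π-update-outside b q e (<⇒≤ b<q)) (e b (<⇒≢ b<q))

  -- Multiplying `n` by a prime `q` changes `val i n` only at `i = q`; this turns such a local
  -- change into one scalar factor of the whole product.
  Π-update : ∀ b q {c f g} → (∀ i → i ≢ q → f i ≡ g i) → f q ≡ c * g q → q < b → Π b f ≡ c * Π b g
  Π-update (suc b) q {c} {f} {g} e eq q<b with b ≟ q
  ... | yes refl = trans (cong₂ _*_ (Π-update-outside b b e ≤-refl) eq) (swap (Π b g) c (g b))
    where
    swap : ∀ x y z → x * (y * z) ≡ y * (x * z)
    swap = solve-∀
  ... | no  b≢q  = trans (cong₂ _*_ (Π-update b q {c} e eq (≤∧≢⇒< (s≤s⁻¹ q<b) (b≢q ∘ sym))) (e b b≢q))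
                         (*-assoc c _ _)

  filter-upTo-suc : ∀ {P : ℕ → Set} (P? : ∀ i → Dec (P i)) b →
    filter P? (upTo (suc b)) ≡ filter P? (upTo b) ++ filter P? [ b ]
  filter-upTo-suc P? b = trans (cong (filter P?) (sym (upTo-∷ʳ b))) (filter-++ P? (upTo b) [ b ])

  -- The bridge from the filtered lists in the definitions of `σ*` and `φ*` to `Π`: rejected indices
  -- become factors 1.
  product-map-filter-upTo : ∀ {P : ℕ → Set} (P? : ∀ i → Dec (P i)) (c f : ℕ → ℕ) b →
    (∀ i → P i → c i ≡ f i) → (∀ i → ¬ P i → f i ≡ 1) →
    product (map c (filter P? (upTo b))) ≡ Π b f
  product-map-filter-upTo P? c f zero    py pn = refl
  product-map-filter-upTo P? c f (suc b) py pn = begin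
    product (map c (filter P? (upTo (suc b))))
      ≡⟨ cong (product ∘ map c) (filter-upTo-suc P? b) ⟩
    product (map c (filter P? (upTo b) ++ filter P? [ b ]))
      ≡⟨ cong product (map-++ c (filter P? (upTo b)) (filter P? [ b ])) ⟩
    product (map c (filter P? (upTo b)) ++ map c (filter P? [ b ]))
      ≡⟨ product-++ (map c (filter P? (upTo b))) _ ⟩
    product (map c (filter P? (upTo b))) * product (map c (filter P? [ b ]))
      ≡⟨ cong₂ _*_ (product-map-filter-upTo P? c f b py pn) last ⟩
    Π b f * f b ∎
    where
    open ≡-Reasoning
    last : product (map c (filter P? [ b ])) ≡ f b
    last with P? b
    ... | yes pb = trans (*-identityʳ _) (py b pb)
    ... | no ¬pb = sym (pn b ¬pb)

  -- The default 1 lets a product over primes run over all integers of an interval.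
  onPrime : ℕ → ℕ → ℕ
  onPrime i x with prime? i
  ... | yes _ = x
  ... | no  _ = 1

  onPrime-elim : ∀ (R : ℕ → Set) i {x} → R 1 → (Prime i → R x) → R (onPrime i x)
  onPrime-elim R i r1 rx with prime? i
  ... | yes pi = rx pi
  ... | no  _  = r1

  onPrime-elim₂ : ∀ (R : ℕ → ℕ → Set) i {x y} → R 1 1 → (Prime i → R x y) → R (onPrime i x) (onPrime i y)
  onPrime-elim₂ R i r1 rx with prime? i
  ... | yes pi = rx pi
  ... | no  _  = r1

  onPrime-elim₃ : ∀ (R : ℕ → ℕ → ℕ → Set) i {x y z} → R 1 1 1 → (Prime i → R x y z) →
    R (onPrime i x) (onPrime i y) (onPrime i z)
  onPrime-elim₃ R i r1 rx with prime? i
  ... | yes pi = rx pi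
  ... | no  _  = r1

  onPrime-prime : ∀ {i x} → Prime i → onPrime i x ≡ x
  onPrime-prime {i} pi with prime? i
  ... | yes _  = refl
  ... | no ¬pi = contradiction pi ¬pi

  prime>1 : ∀ {p} → Prime p → 1 < p
  prime>1 pp = nonTrivial⇒n>1 _ {{prime⇒nonTrivial pp}}

  ^-pos : ∀ {p} e → 0 < p → 0 < p ^ e
  ^-pos zero    h = s≤s z≤n
  ^-pos (suc e) h = *-mono-≤ h (^-pos e h)

  -- Multiplicities and multiplicative functions

  -- Each division by `p > 1` strictly decreases a positive number, so fuel `n` cannot run out
  -- before the cofactor is free of `p`.
  valF-spec : ∀ f p n → 1 < p → 0 < n → n ≤ f → ∃[ c ] (n ≡ p ^ valF f p n * c × ¬ p ∣ c)
  valF-spec zero    p zero    1<p () n≤f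
  valF-spec (suc f) p (suc n) 1<p 0<n n≤f with p ∣? suc n
  ... | no ¬d = suc n , sym (*-identityˡ _) , ¬d
  ... | yes (divides zero ())
  ... | yes (divides (suc q) e)
    with c , e' , nd ← valF-spec f p (suc q) 1<p (s≤s z≤n)
           (s≤s⁻¹ (≤-trans (≤-trans (m<m*n (suc q) p 1<p) (≤-reflexive (sym e))) n≤f))
    = c , trans e (trans (cong (_* p) e') (rearrange (p ^ valF f p (suc q)) c p)) , nd
    where
    rearrange : ∀ x y z → x * y * z ≡ z * x * y
    rearrange = solve-∀

  val-spec : ∀ p {n} → 1 < p → 0 < n → ∃[ c ] (n ≡ p ^ val p n * c × ¬ p ∣ c)
  val-spec p {n} 1<p 0<n = valF-spec n p n 1<p 0<n ≤-refl

  ^-exponent-unique : ∀ {p} a b {c d} → 0 < p → p ^ a * c ≡ p ^ b * d → ¬ p ∣ c → ¬ p ∣ d → a ≡ b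
  ^-exponent-unique zero    zero    h e nc nd = refl
  ^-exponent-unique {p} zero (suc b) {c} {d} h e nc nd =
    contradiction (divides (p ^ b * d) (trans (sym (*-identityˡ c)) (trans e (rearrange p (p ^ b) d)))) nc
    where
    rearrange : ∀ x y z → x * y * z ≡ y * z * x
    rearrange = solve-∀
  ^-exponent-unique {p} (suc a) zero {c} {d} h e nc nd =
    contradiction (divides (p ^ a * c) (trans (sym (*-identityˡ d)) (trans (sym e) (rearrange p (p ^ a) c)))) nd
    where
    rearrange : ∀ x y z → x * y * z ≡ y * z * x
    rearrange = solve-∀
  ^-exponent-unique {p} (suc a) (suc b) {c} {d} h e nc nd = cong suc (^-exponent-unique a b h
    (*-cancelˡ-≡ _ _ p {{>-nonZero h}}
      (trans (sym (*-assoc p (p ^ a) c)) (trans e (*-assoc p (p ^ b) d)))) nc nd)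

  val-unique : ∀ {p n} a {c} → 1 < p → 0 < n → n ≡ p ^ a * c → ¬ p ∣ c → val p n ≡ a
  val-unique {p} {n} a 1<p 0<n e nc with d , e' , nd ← val-spec p {n} 1<p 0<n =
    ^-exponent-unique (val p n) a (<⇒≤ 1<p) (trans (sym e') e) nd nc

  val-* : ∀ {p} m n → Prime p → 0 < m → 0 < n → val p (m * n) ≡ val p m + val p n
  val-* {p} m n pp 0<m 0<n
    with c , e , nc ← val-spec p {m} (prime>1 pp) 0<m
       | d , e' , nd ← val-spec p {n} (prime>1 pp) 0<n
    = val-unique (val p m + val p n) {c * d} (prime>1 pp) (*-mono-≤ 0<m 0<n) eq
        (λ h → [ nc , nd ]′ (euclidsLemma c d pp h))
    where
    interchange : ∀ x y u v → x * y * (u * v) ≡ x * u * (y * v)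
    interchange = solve-∀
    eq : m * n ≡ p ^ (val p m + val p n) * (c * d)
    eq = trans (cong₂ _*_ e e') (trans (interchange (p ^ val p m) c (p ^ val p n) d)
           (cong (_* (c * d)) (sym (^-distribˡ-+-* p (val p m) (val p n)))))

  ∤⇒val≡0 : ∀ {p n} → 1 < p → 0 < n → ¬ p ∣ n → val p n ≡ 0
  ∤⇒val≡0 1<p 0<n nd = val-unique 0 1<p 0<n (sym (*-identityˡ _)) nd

  val≡0⇒∤ : ∀ {p n} → 1 < p → 0 < n → val p n ≡ 0 → ¬ p ∣ n
  val≡0⇒∤ {p} {n} 1<p 0<n v d with c , e , nc ← val-spec p {n} 1<p 0<n rewrite v | *-identityˡ c | e = nc d

  p^val∣ : ∀ {p n} → 1 < p → 0 < n → p ^ val p n ∣ n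
  p^val∣ {p} {n} 1<p 0<n with c , e , nc ← val-spec p {n} 1<p 0<n =
    divides c (trans e (*-comm (p ^ val p n) c))

  val-1 : ∀ {p} → 1 < p → val p 1 ≡ 0
  val-1 1<p = ∤⇒val≡0 1<p (s≤s z≤n) (>⇒∤ 1<p)

  val-self : ∀ {p} → 1 < p → val p p ≡ 1
  val-self {p} 1<p = val-unique 1 1<p (<⇒≤ 1<p) (eq p) (>⇒∤ 1<p)
    where
    eq : ∀ p → p ≡ p ^ 1 * 1
    eq p = sym (trans (*-identityʳ _) (*-identityʳ p))

  prime∣prime⇒≡ : ∀ {p q} → Prime p → Prime q → p ∣ q → p ≡ q
  prime∣prime⇒≡ pp pq d with prime⇒irreducible pq d
  ... | inj₁ refl = contradiction pp ¬prime[1]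
  ... | inj₂ e    = e

  val-prime-≢ : ∀ {p q} → Prime p → Prime q → p ≢ q → val p q ≡ 0
  val-prime-≢ pp pq ne = ∤⇒val≡0 (prime>1 pp) (<⇒≤ (prime>1 pq)) (ne ∘ prime∣prime⇒≡ pp pq)

  val-p* : ∀ {p n} → Prime p → 0 < n → val p (p * n) ≡ suc (val p n)
  val-p* {p} {n} pp 0<n = trans (val-* p n pp (<⇒≤ (prime>1 pp)) 0<n) (cong (_+ val p n) (val-self (prime>1 pp)))

  val-≢-* : ∀ {i q n} → Prime i → Prime q → i ≢ q → 0 < n → val i (q * n) ≡ val i n
  val-≢-* {i} {q} {n} pi pq ne 0<n =
    trans (val-* q n pi (<⇒≤ (prime>1 pq)) 0<n) (cong (_+ val i n) (val-prime-≢ pi pq ne))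

  p^j∣⇒j≤val : ∀ {p n} j → Prime p → 0 < n → p ^ j ∣ n → j ≤ val p n
  p^j∣⇒j≤val zero pp 0<n d = z≤n
  p^j∣⇒j≤val {p} {n} (suc j) pp 0<n (divides zero e) = contradiction e (<⇒≢ 0<n ∘ sym)
  p^j∣⇒j≤val {p} {n} (suc j) pp 0<n (divides (suc q) e) =
    subst (suc j ≤_) (sym (trans (cong (val p) (trans e (rearrange (suc q) p (p ^ j))))
      (val-p* pp (*-mono-≤ (s≤s {0} {q} z≤n) (^-pos j (<⇒≤ (prime>1 pp)))))))
      (s≤s (p^j∣⇒j≤val j pp (*-mono-≤ (s≤s {0} {q} z≤n) (^-pos j (<⇒≤ (prime>1 pp)))) (divides (suc q) refl)))
    where
    rearrange : ∀ x y z → x * (y * z) ≡ y * (x * z)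
    rearrange = solve-∀

  -- ∏ over the primes i < b of h i (v_i(n)); with h i 0 = 1 and b > n this is the multiplicative
  -- function taking the value h p e at p^e.
  Mult : (ℕ → ℕ → ℕ) → ℕ → ℕ → ℕ
  Mult h b n = Π b (λ i → onPrime i (h i (val i n)))

  -- Exponent 0 is a separate case of `σᵖ` and `φᵖ` because a prime not dividing `n` must contribute
  -- 1, whereas `p ^ 0 + 1` is 2 and `p ^ 0 ∸ 1` is 0.
  idᵖ σᵖ φᵖ : ℕ → ℕ → ℕ
  idᵖ p e       = p ^ e
  σᵖ p zero    = 1
  σᵖ p (suc e) = p ^ suc e + 1
  φᵖ p zero    = 1
  φᵖ p (suc e) = p ^ suc e ∸ 1

  Mult-p* : ∀ h {p b n c} → Prime p → p < b → 0 < n → h p (suc (val p n)) ≡ c * h p (val p n) →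
    Mult h b (p * n) ≡ c * Mult h b n
  Mult-p* h {p} {b} {n} {c} pp p<b 0<n hc = Π-update b p {c}
    (λ i i≢p → onPrime-elim₂ _≡_ i refl (λ pi → cong (h i) (val-≢-* pi pp i≢p 0<n)))
    (trans (onPrime-prime pp) (trans (cong (h p) (val-p* pp 0<n)) (trans hc (cong (c *_) (sym (onPrime-prime pp))))))
    p<b

  -- Primes beyond `n` have exponent 0 in it, so the range can be enlarged and several numbers
  -- expanded over a common one.
  Mult-extend : ∀ h {n b} d → (∀ i → h i 0 ≡ 1) → 0 < n → n < b → Mult h (d + b) n ≡ Mult h b n
  Mult-extend h {n} {b} d h0 0<n n<b = Π-extend b d
    (λ i b≤i → onPrime-elim (_≡ 1) i refl
      (λ pi → trans (cong (h i) (∤⇒val≡0 (prime>1 pi) 0<n (>⇒∤ {{>-nonZero 0<n}} (≤-trans n<b b≤i)))) (h0 i)))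

  product-pos : ∀ {ps} → All Prime ps → 0 < product ps
  product-pos = productOfPrimes≥1

  Mult-1 : ∀ h b → (∀ i → h i 0 ≡ 1) → Mult h b 1 ≡ 1
  Mult-1 h b h0 = Π≡1 b (λ i → onPrime-elim (_≡ 1) i refl (λ pi → trans (cong (h i) (val-1 (prime>1 pi))) (h0 i)))

  Mult-idᵖ-product : ∀ b ps → All Prime ps → All (_< b) ps → Mult idᵖ b (product ps) ≡ product ps
  Mult-idᵖ-product b []       []        []        = Mult-1 idᵖ b (λ _ → refl)
  Mult-idᵖ-product b (p ∷ ps) (pp ∷ pr) (p<b ∷ l) =
    trans (Mult-p* idᵖ {p} {b} {product ps} {p} pp p<b (product-pos pr) refl) (cong (p *_) (Mult-idᵖ-product b ps pr l))

  primes≤product : ∀ ps → All Prime ps → All (_≤ product ps) ps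
  primes≤product []       []        = []
  primes≤product (p ∷ ps) (pp ∷ pr) =
    m≤m*n p (product ps) {{>-nonZero (product-pos pr)}} ∷
    All.map (λ {x} h → ≤-trans h (m≤n*m (product ps) p {{prime⇒nonZero pp}})) (primes≤product ps pr)

  -- A factorisation into primes, each at most `n` and hence below `b`, recovers `n` from its
  -- valuations.
  Mult-idᵖ : ∀ {b n} → 0 < n → n < b → Mult idᵖ b n ≡ n
  Mult-idᵖ {b} {n} 0<n n<b = subst (λ x → Mult idᵖ b x ≡ x) (sym isFactorisation)
    (Mult-idᵖ-product b factors factorsPrime
      (All.map (λ {x} h → ≤-<-trans (subst (x ≤_) (sym isFactorisation) h) n<b) (primes≤product factors factorsPrime)))
    where open PrimeFactorisation (factorise n {{>-nonZero 0<n}})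

  primePowerParts-Mult : ∀ (c : ℕ → ℕ) h → (∀ i → h i 0 ≡ 1) → (∀ i e → h i (suc e) ≡ c (i ^ suc e)) →
    ∀ {b n} → 0 < n → n < b → product (map c (primePowerParts n)) ≡ Mult h b n
  primePowerParts-Mult c h h0 hs {b} {n} 0<n n<b =
    trans (cong product (sym (map-∘ (primeDivisors n))))
    (trans (product-map-filter-upTo (λ p → prime? p ×-dec p ∣? n) _ _ (suc n) yes-case no-case)
    (trans (sym (Mult-extend h {n} {suc n} (b ∸ suc n) h0 0<n ≤-refl))
           (cong (λ x → Mult h x n) (m∸n+n≡m n<b))))
    where
    yes-case : ∀ i → Prime i × i ∣ n → c (i ^ val i n) ≡ onPrime i (h i (val i n))
    yes-case i (pi , d) rewrite onPrime-prime {i} {h i (val i n)} pi with val i n in eq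
    ... | zero  = contradiction d (val≡0⇒∤ (prime>1 pi) 0<n eq)
    ... | suc e = sym (hs i e)
    no-case : ∀ i → ¬ (Prime i × i ∣ n) → onPrime i (h i (val i n)) ≡ 1
    no-case i nd = onPrime-elim (_≡ 1) i refl
      (λ pi → trans (cong (h i) (∤⇒val≡0 (prime>1 pi) 0<n (λ d → nd (pi , d)))) (h0 i))

  σ*-Mult : ∀ {b n} → 0 < n → n < b → σ* n ≡ Mult σᵖ b n
  σ*-Mult = primePowerParts-Mult (λ q → q + 1) σᵖ (λ _ → refl) (λ _ _ → refl)

  φ*-Mult : ∀ {b n} → 0 < n → n < b → φ* n ≡ Mult φᵖ b n
  φ*-Mult = primePowerParts-Mult (λ q → q ∸ 1) φᵖ (λ _ → refl) (λ _ _ → refl)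

  -- Submultiplicativity of `σ*`; `φ*` at a new prime; positivity.

  σᵖ-+ : ∀ p d e → 0 < p → σᵖ p (d + e) ≤ σᵖ p d * σᵖ p e
  σᵖ-+ p zero    e       h = ≤-reflexive (sym (*-identityˡ _))
  σᵖ-+ p (suc d) zero    h rewrite +-identityʳ d | *-identityʳ (p ^ suc d + 1) = ≤-refl
  σᵖ-+ p (suc d) (suc e) h = begin
    p ^ (suc d + suc e) + 1                               ≡⟨ cong (_+ 1) (^-distribˡ-+-* p (suc d) (suc e)) ⟩
    p ^ suc d * p ^ suc e + 1                             ≤⟨ m≤m+n _ (p ^ suc d + p ^ suc e) ⟩
    p ^ suc d * p ^ suc e + 1 + (p ^ suc d + p ^ suc e)   ≡⟨ expand (p ^ suc d) (p ^ suc e) ⟩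
    (p ^ suc d + 1) * (p ^ suc e + 1)                     ∎
    where
    open ≤-Reasoning
    expand : ∀ x y → x * y + 1 + (x + y) ≡ (x + 1) * (y + 1)
    expand = solve-∀

  -- Valuations add, so `σᵖ-+` compares the factors prime by prime once all three numbers are
  -- expanded over the range `b`.
  σ*-submult : ∀ u v → 0 < u → 0 < v → σ* (u * v) ≤ σ* u * σ* v
  σ*-submult u v 0<u 0<v = begin
    σ* (u * v)            ≡⟨ σ*-Mult (*-mono-≤ 0<u 0<v) ≤-refl ⟩
    Mult σᵖ b (u * v)     ≤⟨ Π-mono b (λ i → onPrime-elim₃ (λ x y z → x ≤ y * z) i ≤-refl (termwise i)) ⟩
    Π b (λ i → onPrime i (σᵖ i (val i u)) * onPrime i (σᵖ i (val i v))) ≡⟨ Π-* b _ _ ⟩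
    Mult σᵖ b u * Mult σᵖ b v ≡⟨ cong₂ _*_ (sym (σ*-Mult 0<u (s≤s (m≤m*n u v {{>-nonZero 0<v}}))))
                                           (sym (σ*-Mult 0<v (s≤s (m≤n*m v u {{>-nonZero 0<u}})))) ⟩
    σ* u * σ* v           ∎
    where
    open ≤-Reasoning
    b = suc (u * v)
    termwise : ∀ i → Prime i → σᵖ i (val i (u * v)) ≤ σᵖ i (val i u) * σᵖ i (val i v)
    termwise i pi rewrite val-* u v pi 0<u 0<v = σᵖ-+ i (val i u) (val i v) (<⇒≤ (prime>1 pi))

  φ*-p* : ∀ {p n} → Prime p → 0 < n → ¬ p ∣ n → φ* (p * n) ≡ (p ∸ 1) * φ* n
  φ*-p* {p} {n} pp 0<n nd = begin
    φ* (p * n)              ≡⟨ φ*-Mult (*-mono-≤ 0<p 0<n) ≤-refl ⟩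
    Mult φᵖ b (p * n)       ≡⟨ Mult-p* φᵖ {c = p ∸ 1} pp (s≤s (m≤m*n p n {{>-nonZero 0<n}})) 0<n at-p ⟩
    (p ∸ 1) * Mult φᵖ b n   ≡⟨ cong ((p ∸ 1) *_) (sym (φ*-Mult 0<n (s≤s (m≤n*m n p {{>-nonZero 0<p}})))) ⟩
    (p ∸ 1) * φ* n          ∎
    where
    open ≡-Reasoning
    b = suc (p * n)
    0<p = <⇒≤ (prime>1 pp)
    at-p : φᵖ p (suc (val p n)) ≡ (p ∸ 1) * φᵖ p (val p n)
    at-p rewrite ∤⇒val≡0 (prime>1 pp) 0<n nd | *-identityʳ p | *-identityʳ (p ∸ 1) = refl

  φ*-pos : ∀ {n} → 0 < n → 0 < φ* n
  φ*-pos {n} 0<n = subst (0 <_) (sym (φ*-Mult 0<n ≤-refl))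
    (Π-pos (suc n) (λ i → onPrime-elim (0 <_) i (s≤s z≤n) (λ pi → φᵖ-pos i (val i n) (prime>1 pi))))
    where
    φᵖ-pos : ∀ p e → 1 < p → 0 < φᵖ p e
    φᵖ-pos p zero    h = s≤s z≤n
    φᵖ-pos p (suc e) h = m<n⇒0<n∸m (≤-trans h (m≤m*n p (p ^ e) {{>-nonZero (^-pos e (<⇒≤ h))}}))

  -- Chebyshev's lower bound for the number of primes

  -- binom i j is the binomial coefficient "i + j choose i".
  binom : ℕ → ℕ → ℕ
  binom zero    j       = 1
  binom (suc i) zero    = 1
  binom (suc i) (suc j) = binom i (suc j) + binom (suc i) j

  binom-0 : ∀ i → binom i 0 ≡ 1
  binom-0 zero    = refl
  binom-0 (suc i) = refl

  -- The two absorption identities share their right-hand side, so together they trade one Pascal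
  -- summand for the other. Each induction needs this trade, hence the mutual recursion.
  binom-absorbˡ : ∀ i j → suc i * binom (suc i) j ≡ suc (i + j) * binom i j
  binom-absorbʳ : ∀ i j → suc j * binom i (suc j) ≡ suc (i + j) * binom i j
  binom-absorbˡ i       zero    rewrite binom-0 i | +-identityʳ i = refl
  binom-absorbˡ zero    (suc j) = trans (trans (+-identityʳ _) (cong suc
    (trans (sym (+-identityʳ _)) (binom-absorbˡ zero j)))) refl
  binom-absorbˡ (suc i) (suc j) = begin
    suc (suc i) * (binom (suc i) (suc j) + binom (suc (suc i)) j)
      ≡⟨ *-distribˡ-+ (suc (suc i)) (binom (suc i) (suc j)) _ ⟩
    suc (suc i) * binom (suc i) (suc j) + suc (suc i) * binom (suc (suc i)) j
      ≡⟨ cong (suc (suc i) * binom (suc i) (suc j) +_) (trans (binom-absorbˡ (suc i) j) (sym (binom-absorbʳ (suc i) j))) ⟩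
    suc (suc i) * binom (suc i) (suc j) + suc j * binom (suc i) (suc j)
      ≡⟨ collect i j (binom (suc i) (suc j)) ⟩
    suc (suc i + suc j) * binom (suc i) (suc j) ∎
    where
    open ≡-Reasoning
    collect : ∀ i j x → suc (suc i) * x + suc j * x ≡ suc (suc i + suc j) * x
    collect = solve-∀
  binom-absorbʳ zero    j = refl
  binom-absorbʳ (suc i) j = begin
    suc j * (binom i (suc j) + binom (suc i) j)
      ≡⟨ *-distribˡ-+ (suc j) (binom i (suc j)) _ ⟩
    suc j * binom i (suc j) + suc j * binom (suc i) j
      ≡⟨ cong (_+ suc j * binom (suc i) j) (trans (binom-absorbʳ i j) (sym (binom-absorbˡ i j))) ⟩
    suc i * binom (suc i) j + suc j * binom (suc i) j
      ≡⟨ collect i j (binom (suc i) j) ⟩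
    suc (suc i + j) * binom (suc i) j ∎
    where
    open ≡-Reasoning
    collect : ∀ i j x → suc i * x + suc j * x ≡ suc (suc i + j) * x
    collect = solve-∀

  binom-sucʳ-≤ : ∀ i j → binom i j ≤ binom i (suc j)
  binom-sucʳ-≤ zero    j = ≤-refl
  binom-sucʳ-≤ (suc i) j = m≤n+m _ _

  binom-sucˡ-≤ : ∀ i j → binom i j ≤ binom (suc i) j
  binom-sucˡ-≤ i zero    = ≤-reflexive (binom-0 i)
  binom-sucˡ-≤ i (suc j) = m≤m+n _ _

  -- Both Pascal summands of the next central binomial coefficient are at least the previous one.
  2^m≤binom : ∀ m → 2 ^ m ≤ binom m m
  2^m≤binom zero    = ≤-refl
  2^m≤binom (suc m) = ≤-trans (*-monoʳ-≤ 2 (2^m≤binom m))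
    (+-mono-≤ (binom-sucʳ-≤ m m) (≤-trans (≤-reflexive (+-identityʳ _)) (binom-sucˡ-≤ m m)))

  -- The entries 1 / ((i+j+1) binom i j) of Leibniz's harmonic triangle satisfy
  -- entry(i+1, j) = entry(i, j) - entry(i, j+1).
  leibniz-∣ : ∀ i j {L} → (∀ n → n ≤ i + j → suc n ∣ L) → suc (i + j) * binom i j ∣ L
  leibniz-∣ zero    j {L} h = subst (_∣ L) (sym (*-identityʳ (suc j))) (h j ≤-refl)
  leibniz-∣ (suc i) j {L} h
    with divides c ec ← leibniz-∣ i j {L} (λ n n≤ → h n (m≤n⇒m≤1+n n≤))
       | divides d ed ← leibniz-∣ i (suc j) {L} (λ n n≤ → h n (subst (n ≤_) (+-suc i j) n≤))
    = ∣m+n∣m⇒∣n (divides c (trans (+-comm (d * (suc s * Z)) L) (sym key))) (n∣m*n d)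
    where
    s = suc (i + j)
    X = binom i j
    Y = binom i (suc j)
    Z = binom (suc i) j
    open ≡-Reasoning
    L≡cZ : L ≡ c * (suc i * Z)
    L≡cZ = trans ec (cong (c *_) (sym (binom-absorbˡ i j)))
    L≡dY : L ≡ d * (suc s * Y)
    L≡dY = trans ed (cong (λ x → d * (suc x * Y)) (+-suc i j))
    shuffle₁ : ∀ a c s z → a * (c * (s * z)) ≡ s * (c * (a * z))
    shuffle₁ = solve-∀
    shuffle₂ : ∀ i j L → suc (suc (i + j)) * L ≡ suc i * L + suc j * L
    shuffle₂ = solve-∀
    shuffle₃ : ∀ j d s Y → suc j * (d * (s * Y)) ≡ d * s * (suc j * Y)
    shuffle₃ = solve-∀
    shuffle₄ : ∀ i d s Z → d * s * (suc i * Z) ≡ suc i * (d * (s * Z))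
    shuffle₄ = solve-∀
    -- `c` and `d` are `L` times the entries at `(i, j)` and `(i, j+1)`, so by the recursion `c - d`
    -- is `L` times the entry at `(i+1, j)`; this says so without subtraction.
    key : c * (suc s * Z) ≡ L + d * (suc s * Z)
    key = *-cancelˡ-≡ _ _ (suc i) (begin
      suc i * (c * (suc s * Z))             ≡⟨ shuffle₁ (suc i) c (suc s) Z ⟩
      suc s * (c * (suc i * Z))             ≡⟨ cong (suc s *_) (sym L≡cZ) ⟩
      suc s * L                             ≡⟨ shuffle₂ i j L ⟩
      suc i * L + suc j * L                 ≡⟨ cong (λ x → suc i * L + suc j * x) L≡dY ⟩
      suc i * L + suc j * (d * (suc s * Y)) ≡⟨ cong (suc i * L +_) (shuffle₃ j d (suc s) Y) ⟩
      suc i * L + d * suc s * (suc j * Y)   ≡⟨ cong (λ x → suc i * L + d * suc s * x)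
                                                 (trans (binom-absorbʳ i j) (sym (binom-absorbˡ i j))) ⟩
      suc i * L + d * suc s * (suc i * Z)   ≡⟨ cong (suc i * L +_) (shuffle₄ i d (suc s) Z) ⟩
      suc i * L + suc i * (d * (suc s * Z)) ≡⟨ sym (*-distribˡ-+ (suc i) L _) ⟩
      suc i * (L + d * (suc s * Z))         ∎)

  -- The exponent of `p` in the least common multiple of 1, ..., `M`.
  maxval : ℕ → ℕ → ℕ
  maxval p zero    = 0
  maxval p (suc M) = val p (suc M) ⊔ maxval p M

  val≤maxval : ∀ p i {M} → 0 < i → i ≤ M → val p i ≤ maxval p M
  val≤maxval p (suc i) {suc M} 0<i i≤M with m≤n⇒m<n∨m≡n i≤M
  ... | inj₁ (s≤s i≤M′) = ≤-trans (val≤maxval p (suc i) 0<i i≤M′) (m≤n⊔m (val p (suc M)) _)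
  ... | inj₂ refl       = m≤m⊔n _ _

  -- The maximum is attained at some positive integer in the range, and the corresponding power of
  -- `p` divides that integer.
  ^maxval≤ : ∀ {p} M → 1 < p → p ^ maxval p (suc M) ≤ suc M
  ^maxval≤ {p} zero    1<p rewrite val-1 1<p = ≤-refl
  ^maxval≤ {p} (suc M) 1<p with ⊔-sel (val p (suc (suc M))) (maxval p (suc M))
  ... | inj₁ e rewrite e = ∣⇒≤ (p^val∣ {p} {suc (suc M)} 1<p (s≤s z≤n))
  ... | inj₂ e rewrite e = m≤n⇒m≤1+n (^maxval≤ M 1<p)

  ^-monoʳ-∣ : ∀ p {a b} → a ≤ b → p ^ a ∣ p ^ b
  ^-monoʳ-∣ p {a} {b} a≤b = divides (p ^ (b ∸ a))
    (trans (cong (p ^_) (sym (m∸n+n≡m a≤b))) (^-distribˡ-+-* p (b ∸ a) a))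

  primes< : ℕ → List ℕ
  primes< b = filter prime? (upTo b)

  -- Built from its prime powers rather than by iterated lcm, so that its size can be read off: each
  -- prime contributes a factor at most `M`.
  lcm≤ : ℕ → ℕ
  lcm≤ M = Π (suc M) (λ p → onPrime p (p ^ maxval p M))

  ∣lcm≤ : ∀ {i M} → 0 < i → i ≤ M → i ∣ lcm≤ M
  ∣lcm≤ {i} {M} 0<i i≤M = subst (_∣ lcm≤ M) (Mult-idᵖ 0<i (s≤s i≤M))
    (Π-pres-∣ (suc M) (λ p → onPrime-elim₂ _∣_ p ∣-refl (λ pp → ^-monoʳ-∣ p (val≤maxval p i 0<i i≤M))))

  product-map-const : ∀ c (xs : List ℕ) → product (map (λ _ → c) xs) ≡ c ^ length xs
  product-map-const c []       = refl
  product-map-const c (x ∷ xs) = cong (c *_) (product-map-const c xs)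

  lcm≤-bound : ∀ M → lcm≤ (suc M) ≤ suc M ^ length (primes< (2 + M))
  lcm≤-bound M = begin
    lcm≤ (suc M)
      ≤⟨ Π-mono (2 + M) (λ p → onPrime-elim₂ _≤_ p ≤-refl (λ pp → ^maxval≤ M (prime>1 pp))) ⟩
    Π (2 + M) (λ p → onPrime p (suc M))
      ≡⟨ sym (product-map-filter-upTo prime? (λ _ → suc M) _ (2 + M) (λ p pp → sym (onPrime-prime pp))
           (λ p np → onPrime-elim (_≡ 1) p refl (λ pp → contradiction pp np))) ⟩
    product (map (λ _ → suc M) (primes< (2 + M)))
      ≡⟨ product-map-const (suc M) (primes< (2 + M)) ⟩
    suc M ^ length (primes< (2 + M)) ∎
    where open ≤-Reasoning

  ^-cancelʳ-≤ : ∀ a b → 2 ^ a ≤ 2 ^ b → a ≤ b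
  ^-cancelʳ-≤ a b h with a ≤? b
  ... | yes p = p
  ... | no ¬p = contradiction h (<⇒≱ (^-monoʳ-< 2 (s≤s (s≤s z≤n)) (≰⇒> ¬p)))

  -- With `m = 2 ^ w`, the multiple `(2m+1) binom m m` of the central coefficient divides lcm(1,
  -- ..., 2m+1), which is at most 2m+1 to the number of primes up to 2m+1. As 2m+1 is at most
  -- `2 ^ (w + 2)`, comparing exponents of 2 gives the bound.
  chebyshev : ∀ w → 2 ^ w ≤ (w + 2) * length (primes< (2 + (2 ^ w + 2 ^ w)))
  chebyshev w = ^-cancelʳ-≤ _ _ (begin
    2 ^ m                          ≤⟨ 2^m≤binom m ⟩
    binom m m                      ≤⟨ m≤n*m (binom m m) (suc (m + m)) ⟩
    suc (m + m) * binom m m        ≤⟨ ∣⇒≤ {{>-nonZero lcm-pos}} (leibniz-∣ m m (λ n n≤ → ∣lcm≤ (s≤s z≤n) (s≤s n≤))) ⟩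
    lcm≤ (suc (m + m))             ≤⟨ lcm≤-bound (m + m) ⟩
    suc (m + m) ^ ℓ                ≤⟨ ^-monoˡ-≤ ℓ size ⟩
    (2 ^ (w + 2)) ^ ℓ              ≡⟨ ^-*-assoc 2 (w + 2) ℓ ⟩
    2 ^ ((w + 2) * ℓ)              ∎)
    where
    open ≤-Reasoning
    m = 2 ^ w
    ℓ = length (primes< (2 + (m + m)))
    lcm-pos : 0 < lcm≤ (suc (m + m))
    lcm-pos = Π-pos (2 + (m + m)) (λ p → onPrime-elim (0 <_) p (s≤s z≤n) (λ pp → ^-pos (maxval p (suc (m + m))) (<⇒≤ (prime>1 pp))))
    size : suc (m + m) ≤ 2 ^ (w + 2)
    size = begin
      1 + (m + m)       ≤⟨ +-monoˡ-≤ (m + m) (^-pos w (s≤s z≤n)) ⟩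
      m + (m + m)       ≤⟨ m≤m+n _ m ⟩
      m + (m + m) + m   ≡⟨ four m ⟩
      m * 4             ≡⟨ sym (^-distribˡ-+-* 2 w 2) ⟩
      2 ^ (w + 2)       ∎
      where
      four : ∀ m → m + (m + m) + m ≡ m * 4
      four = solve-∀

  -- Primes q whose q - 1 share their small divisors

  length-filter-complement : ∀ {P : ℕ → Set} (P? : ∀ i → Dec (P i)) xs →
    length xs ≡ length (filter P? xs) + length (filter (¬? ∘ P?) xs)
  length-filter-complement P? []       = refl
  length-filter-complement P? (x ∷ xs) with P? x
  ... | yes _ = cong suc (length-filter-complement P? xs)
  ... | no  _ = trans (cong suc (length-filter-complement P? xs)) (sym (+-suc _ _))

  -- Only the `K + 1` integers 0, ..., `K` can be lost by discarding small primes; every later prime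
  -- adds 1 to both sides.
  length-primes<-split : ∀ K c →
    length (primes< (c + suc K)) ≤ length (filter (K <?_) (primes< (c + suc K))) + suc K
  length-primes<-split K zero = ≤-trans
    (≤-trans (length-filter prime? (upTo (suc K))) (≤-reflexive (length-upTo (suc K)))) (m≤n+m (suc K) _)
  length-primes<-split K (suc c)
    rewrite filter-upTo-suc prime? (c + suc K)
          | length-++ (primes< (c + suc K)) {filter prime? [ c + suc K ]}
          | filter-++ (K <?_) (primes< (c + suc K)) (filter prime? [ c + suc K ])
          | length-++ (filter (K <?_) (primes< (c + suc K))) {filter (K <?_) (filter prime? [ c + suc K ])}
    with prime? (c + suc K)
  ... | no _ rewrite +-identityʳ (length (primes< (c + suc K)))
                   | +-identityʳ (length (filter (K <?_) (primes< (c + suc K)))) = length-primes<-split K c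
  ... | yes _
    rewrite filter-accept (K <?_) {c + suc K} {[]} (m≤n+m (suc K) c)
          | +-comm (length (primes< (c + suc K))) 1
          | +-comm (length (filter (K <?_) (primes< (c + suc K)))) 1 = s≤s (length-primes<-split K c)

  halve : ∀ {P : ℕ → Set} (P? : ∀ i → Dec (P i)) xs n → 2 * n ≤ length xs →
    n ≤ length (filter P? xs) ⊎ n ≤ length (filter (¬? ∘ P?) xs)
  halve P? xs n h with n ≤? length (filter P? xs) | n ≤? length (filter (¬? ∘ P?) xs)
  ... | yes p | _     = inj₁ p
  ... | no _  | yes q = inj₂ q
  ... | no p  | no q  = contradiction h (<⇒≱ (≤-trans (≤-reflexive (cong suc (length-filter-complement P? xs)))
        (≤-trans (+-mono-≤ (≰⇒> p) (<⇒≤ (≰⇒> q))) (≤-reflexive (cong (n +_) (sym (+-identityʳ n)))))))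

  -- Pigeonhole: for each of the `t` properties the larger half of the list is kept. The predicate
  -- `R` carries along the decisions already made.
  homogeneous-sublist : ∀ {D : ℕ → ℕ → Set} (D? : ∀ i x → Dec (D i x)) t m (R : ℕ → Set) xs →
    Unique xs → All R xs → 2 ^ t * m ≤ length xs →
    ∃[ ys ] (Unique ys × All R ys × m ≤ length ys × (∀ i → i < t → All (D i) ys ⊎ All (λ x → ¬ D i x) ys))
  homogeneous-sublist D? zero m R xs ux rx h = xs , ux , rx , ≤-trans (≤-reflexive (sym (+-identityʳ m))) h , λ i ()
  homogeneous-sublist {D} D? (suc t) m R xs ux rx h
    with halve (D? t) xs (2 ^ t * m) (≤-trans (≤-reflexive (sym (*-assoc 2 (2 ^ t) m))) h)
  ... | inj₁ l
    with ys , uy , ry , ly , hy ← homogeneous-sublist D? t m (λ x → R x × D t x) (filter (D? t) xs)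
           (Unique.filter⁺ (D? t) ux) (All.zip (All.filter⁺ (D? t) rx , All.all-filter (D? t) xs)) l
    = ys , uy , All.map proj₁ ry , ly , λ i i<st → [ hy i , (λ { refl → inj₁ (All.map proj₂ ry) }) ]′ (m≤n⇒m<n∨m≡n (s≤s⁻¹ i<st))
  ... | inj₂ l
    with ys , uy , ry , ly , hy ← homogeneous-sublist D? t m (λ x → R x × ¬ D t x) (filter (¬? ∘ D? t) xs)
           (Unique.filter⁺ (¬? ∘ D? t) ux) (All.zip (All.filter⁺ (¬? ∘ D? t) rx , All.all-filter (¬? ∘ D? t) xs)) l
    = ys , uy , All.map proj₁ ry , ly , λ i i<st → [ hy i , (λ { refl → inj₂ (All.map proj₂ ry) }) ]′ (m≤n⇒m<n∨m≡n (s≤s⁻¹ i<st))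

  -- Products of 1 + 1/P

  -- The factors f of σ*(n) and g of n at one prime: 1 and 1 when it does not divide n, else P + 1 and P.
  Over : ℕ → ℕ → ℕ → Set
  Over bound f g = (f ≡ 1 × g ≡ 1) ⊎ (f ≡ g + 1 × bound ≤ g)

  -- ∏ (1 + 1/P_i) for P_i ≥ (K+1) i² is compared with the telescoping product of
  -- (K(i-1)+1) i / ((Ki+1)(i-1)).
  small-product : ∀ K f g → f 0 ≡ 1 → f 1 ≡ 1 → g 0 ≡ 1 → g 1 ≡ 1 → ∀ n →
    (∀ i → i ≤ suc n → Over (suc K * (i * i)) (f i) (g i)) →
    Π (2 + n) f * (K * suc n + 1) ≤ Π (2 + n) g * (suc n * suc K)
  small-product K f g f0 f1 g0 g1 zero h rewrite f0 | f1 | g0 | g1 | *-identityʳ K = ≤-reflexive (base K)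
    where
    base : ∀ K → 1 * 1 * 1 * (K + 1) ≡ 1 * 1 * 1 * (1 * suc K)
    base = solve-∀
  small-product K f g f0 f1 g0 g1 (suc n) h = *-cancelʳ-≤ _ _ (suc n) (begin
    F * f i * (K * i + 1) * j           ≡⟨ s₁ F (f i) (K * i + 1) j ⟩
    F * (f i * (K * i + 1) * j)         ≤⟨ *-monoʳ-≤ F (step (h i ≤-refl)) ⟩
    F * (g i * i * (K * j + 1))         ≡⟨ s₂ F (g i) i (K * j + 1) ⟩
    F * (K * j + 1) * (g i * i)         ≤⟨ *-monoˡ-≤ (g i * i) (small-product K f g f0 f1 g0 g1 n (λ i′ le → h i′ (m≤n⇒m≤1+n le))) ⟩
    G * (j * suc K) * (g i * i)         ≡⟨ s₃ G j (suc K) (g i) i ⟩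
    G * g i * (i * suc K) * j           ∎)
    where
    open ≤-Reasoning
    j = suc n
    i = suc (suc n)
    F = Π (2 + n) f
    G = Π (2 + n) g
    s₁ : ∀ a b c d → a * b * c * d ≡ a * (b * c * d)
    s₁ = solve-∀
    s₂ : ∀ a b c d → a * (b * c * d) ≡ a * d * (b * c)
    s₂ = solve-∀
    s₃ : ∀ a b c d e → a * (b * c) * (d * e) ≡ a * d * (e * c) * b
    s₃ = solve-∀
    -- With `j = i - 1`, `i (Kj + 1)` exceeds `(Ki + 1) j` by exactly 1. A factor `1 + 1/P`
    -- therefore fits as soon as `(Ki + 1) j ≤ P`, which holds for `P ≥ (K+1) i²`.
    step : Over (suc K * (i * i)) (f i) (g i) → f i * (K * i + 1) * j ≤ g i * i * (K * j + 1)
    step (inj₁ (fe , ge)) rewrite fe | ge = ≤-trans (m≤m+n _ 1) (≤-reflexive (e K n))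
      where
      e : ∀ K n → 1 * (K * suc (suc n) + 1) * suc n + 1 ≡ 1 * suc (suc n) * (K * suc n + 1)
      e = solve-∀
    step (inj₂ (fe , P≥)) rewrite fe = begin
      (P + 1) * (K * i + 1) * j                    ≡⟨ e₁ P K n ⟩
      P * ((K * i + 1) * j) + (K * i + 1) * j      ≤⟨ +-monoʳ-≤ _ (≤-trans (m≤m+n _ _) (≤-reflexive (e₂ K n))) ⟩
      P * ((K * i + 1) * j) + suc K * (i * i)      ≤⟨ +-monoʳ-≤ _ P≥ ⟩
      P * ((K * i + 1) * j) + P                    ≡⟨ e₃ P K n ⟩
      P * i * (K * j + 1)                          ∎
      where
      P = g i
      e₁ : ∀ P K n → (P + 1) * (K * suc (suc n) + 1) * suc n ≡ P * ((K * suc (suc n) + 1) * suc n) + (K * suc (suc n) + 1) * suc n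
      e₁ = solve-∀
      e₂ : ∀ K n → (K * suc (suc n) + 1) * suc n + (K * suc (suc n) + (n * n + 3 * n + 3)) ≡ suc K * (suc (suc n) * suc (suc n))
      e₂ = solve-∀
      e₃ : ∀ P K n → P * ((K * suc (suc n) + 1) * suc n) + P ≡ P * suc (suc n) * (K * suc n + 1)
      e₃ = solve-∀

  -- `J` counts the nontrivial factors. Each has `P ≥ W`, whence the lower bound on `Π d g`, and
  -- each `1 + 1/P` is at most `(W - J) / (W - J - 1)`; these telescope to `W / (W - J)`.
  large-product : ∀ W f g d → (∀ i → Over W (f i) (g i)) →
    ∃[ J ] (W ^ J ≤ Π d g × Π d f * (W ∸ J) ≤ Π d g * W)
  large-product W f g zero    h = 0 , ≤-refl , ≤-refl
  large-product W f g (suc d) h with J , p , q ← large-product W f g d h | h d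
  ... | inj₁ (fe , ge) rewrite fe | ge | *-identityʳ (Π d f) | *-identityʳ (Π d g) = J , p , q
  ... | inj₂ (fe , W≤) rewrite fe = suc J ,
      ≤-trans (*-mono-≤ W≤ p) (≤-reflexive (*-comm (g d) (Π d g))) , (begin
      F * (P + 1) * (W ∸ suc J)   ≡⟨ *-assoc F (P + 1) _ ⟩
      F * ((P + 1) * (W ∸ suc J)) ≤⟨ *-monoʳ-≤ F (absorb (J <? W)) ⟩
      F * (P * (W ∸ J))           ≡⟨ s₁ F P (W ∸ J) ⟩
      F * (W ∸ J) * P             ≤⟨ *-monoˡ-≤ P q ⟩
      G * W * P                   ≡⟨ s₂ G W P ⟩
      G * P * W                   ∎)
    where
    open ≤-Reasoning
    F = Π d f
    G = Π d g
    P = g d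
    s₁ : ∀ a b c → a * (b * c) ≡ a * c * b
    s₁ = solve-∀
    s₂ : ∀ a b c → a * b * c ≡ a * c * b
    s₂ = solve-∀
    absorb : Dec (J < W) → (P + 1) * (W ∸ suc J) ≤ P * (W ∸ J)
    -- Here truncated subtraction makes the left side 0.
    absorb (no  J≮W) rewrite m≤n⇒m∸n≡0 {W} {suc J} (m≤n⇒m≤1+n (≮⇒≥ J≮W)) | *-zeroʳ (P + 1) = z≤n
    absorb (yes J<W) = begin
      (P + 1) * (W ∸ suc J)       ≡⟨ s₃ P (W ∸ suc J) ⟩
      P * (W ∸ suc J) + (W ∸ suc J) ≤⟨ +-monoʳ-≤ _ (≤-trans (m∸n≤m W (suc J)) W≤) ⟩
      P * (W ∸ suc J) + P         ≡⟨ s₄ P (W ∸ suc J) ⟩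
      P * suc (W ∸ suc J)         ≡⟨ cong (P *_) (sym (+-∸-assoc 1 J<W)) ⟩
      P * (W ∸ J)                 ∎
      where
      s₃ : ∀ P x → (P + 1) * x ≡ P * x + x
      s₃ = solve-∀
      s₄ : ∀ P x → P * x + P ≡ P * suc x
      s₄ = solve-∀

  Π-split : ∀ b d f → Π (d + b) f ≡ Π b f * Π d (λ i → f (i + b))
  Π-split b zero    f = sym (*-identityʳ _)
  Π-split b (suc d) f = trans (cong (_* f (d + b)) (Π-split b d f)) (*-assoc (Π b f) _ _)

  idᵖ-pos : ∀ p e → Prime p → 0 < idᵖ p e
  idᵖ-pos p e pp = ^-pos e (<⇒≤ (prime>1 pp))

  σᵖ-over-idᵖ : ∀ p e bound → (0 < e → bound ≤ idᵖ p e) → Over bound (σᵖ p e) (idᵖ p e)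
  σᵖ-over-idᵖ p zero    bound h = inj₁ (refl , refl)
  σᵖ-over-idᵖ p (suc e) bound h = inj₂ (refl , h (s≤s z≤n))

  Over-onPrime : ∀ {bound} i {x y} → (Prime i → Over bound x y) → Over bound (onPrime i x) (onPrime i y)
  Over-onPrime {bound} i = onPrime-elim₂ (Over bound) i (inj₁ (refl , refl))

  val>0⇒∣ : ∀ {p n} → Prime p → 0 < n → 0 < val p n → p ∣ n
  val>0⇒∣ {p} {n} pp 0<n 0<v with p ∣? n
  ... | yes d = d
  ... | no nd = contradiction (∤⇒val≡0 (prime>1 pp) 0<n nd) (<⇒≢ 0<v ∘ sym)

  -- The primes dividing `B` are split at `y = n + 1`. Those up to `y` occur to a high power and are
  -- handled by `small-product`; those beyond `y` are few and are handled by `large-product`. Each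
  -- group contributes at most `1 + 1/K`.
  σ*-close : ∀ K n B → 0 < B →
    (∀ p → Prime p → p ≤ suc n → p ∣ B → suc K * (p * p) ≤ p ^ val p B) →
    (∀ J → suc n ^ J ≤ B → J * suc K ≤ suc n) →
    σ* B * (K * K) ≤ B * (suc K * suc K)
  σ*-close K n B 0<B small large = begin
    σ* B * (K * K)              ≡⟨ cong (_* (K * K)) (trans (σ*-Mult 0<B B<T) (Π-split b d f)) ⟩
    F * F′ * (K * K)            ≡⟨ interchange F F′ K K ⟩
    F * K * (F′ * K)            ≤⟨ *-mono-≤ F-bound F′-bound ⟩
    G * suc K * (G′ * suc K)    ≡⟨ interchange G (suc K) G′ (suc K) ⟩
    G * G′ * (suc K * suc K)    ≡⟨ cong (_* (suc K * suc K)) (sym B≡) ⟩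
    B * (suc K * suc K)         ∎
    where
    open ≤-Reasoning
    y = suc n
    b = suc y
    d = suc B
    f g : ℕ → ℕ
    f i = onPrime i (σᵖ i (val i B))
    g i = onPrime i (idᵖ i (val i B))
    F  = Π b f
    G  = Π b g
    F′ = Π d (λ i → f (i + b))
    G′ = Π d (λ i → g (i + b))
    B<T : B < d + b
    B<T = s≤s (m≤m+n B b)
    B≡ : B ≡ G * G′
    B≡ = trans (sym (Mult-idᵖ 0<B B<T)) (Π-split b d g)
    interchange : ∀ w x y z → w * x * (y * z) ≡ w * y * (x * z)
    interchange = solve-∀
    0<G : 0 < G
    0<G = Π-pos b (λ i → onPrime-elim (0 <_) i (s≤s z≤n) (idᵖ-pos i (val i B)))
    F-bound : F * K ≤ G * suc K
    F-bound = *-cancelʳ-≤ _ _ y (begin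
      F * K * y            ≡⟨ *-assoc F K y ⟩
      F * (K * y)          ≤⟨ *-monoʳ-≤ F (m≤m+n (K * y) 1) ⟩
      F * (K * y + 1)      ≤⟨ small-product K f g refl refl refl refl n
                                (λ i i≤y → Over-onPrime i (λ pi → σᵖ-over-idᵖ i (val i B) _
                                  (λ v → small i pi i≤y (val>0⇒∣ pi 0<B v)))) ⟩
      G * (y * suc K)      ≡⟨ cong (G *_) (*-comm y (suc K)) ⟩
      G * (suc K * y)      ≡⟨ sym (*-assoc G (suc K) y) ⟩
      G * suc K * y        ∎)
    over : ∀ i → Over y (f (i + b)) (g (i + b))
    over i = Over-onPrime (i + b) (λ pi → σᵖ-over-idᵖ (i + b) (val (i + b) B) y (λ 0<v →
      ≤-trans (≤-trans (≤-trans (n≤1+n y) (m≤n+m b i)) (≤-reflexive (sym (^-identityʳ (i + b)))))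
              (^-monoʳ-≤ (i + b) {{prime⇒nonZero pi}} 0<v)))
    F′-bound : F′ * K ≤ G′ * suc K
    F′-bound with J , yᴶ≤ , q ← large-product y (λ i → f (i + b)) (λ i → g (i + b)) d over =
      *-cancelʳ-≤ _ _ y (begin
      F′ * K * y                 ≡⟨ *-assoc F′ K y ⟩
      F′ * (K * y)               ≤⟨ *-monoʳ-≤ F′ gap ⟩
      F′ * ((y ∸ J) * suc K)     ≡⟨ sym (*-assoc F′ (y ∸ J) (suc K)) ⟩
      F′ * (y ∸ J) * suc K       ≤⟨ *-monoˡ-≤ (suc K) q ⟩
      G′ * y * suc K             ≡⟨ swap G′ y (suc K) ⟩
      G′ * suc K * y             ∎)
      where
      swap : ∀ a b c → a * b * c ≡ a * c * b
      swap = solve-∀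
      J≤ : J * suc K ≤ y
      J≤ = large J (≤-trans yᴶ≤ (≤-trans (m≤n*m G′ G {{>-nonZero 0<G}}) (≤-reflexive (sym B≡))))
      -- `J ≤ y / (K+1)` is what makes `y / (y - J)` at most `(K+1) / K`.
      gap : K * y ≤ (y ∸ J) * suc K
      gap = begin
        K * y                      ≡⟨ *-comm K y ⟩
        y * K                      ≡⟨ sym (m+n∸m≡n y (y * K)) ⟩
        y + y * K ∸ y              ≡⟨ cong (_∸ y) (sym (*-suc y K)) ⟩
        y * suc K ∸ y              ≤⟨ ∸-monoʳ-≤ (y * suc K) J≤ ⟩
        y * suc K ∸ J * suc K      ≡⟨ sym (*-distribʳ-∸ (suc K) y J) ⟩
        (y ∸ J) * suc K            ∎

  -- Choice of the primes

  n<2^n : ∀ n → n < 2 ^ n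
  n<2^n zero    = s≤s z≤n
  n<2^n (suc n) = ≤-trans (+-mono-≤ (^-pos n (s≤s z≤n)) (n<2^n n)) (≤-reflexive (cong (2 ^ n +_) (sym (+-identityʳ _))))

  ^length∣product : ∀ {p} xs → All (p ∣_) xs → p ^ length xs ∣ product xs
  ^length∣product []       []       = ∣-refl
  ^length∣product (x ∷ xs) (d ∷ ds) = *-pres-∣ d (^length∣product xs ds)

  ∤product : ∀ {p} xs → Prime p → All (λ x → ¬ p ∣ x) xs → ¬ p ∣ product xs
  ∤product []       pp []       d = contradiction (∣1⇒≡1 d) (<⇒≢ (prime>1 pp) ∘ sym)
  ∤product (x ∷ xs) pp (n ∷ ns) d = [ n , ∤product xs pp ns ]′ (euclidsLemma x (product xs) pp d)

  product≤^length : ∀ {c} xs → All (_≤ c) xs → product xs ≤ c ^ length xs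
  product≤^length []       []       = ≤-refl
  product≤^length (x ∷ xs) (l ∷ ls) = *-mono-≤ l (product≤^length xs ls)

  product-pred-pos : ∀ qs → All Prime qs → 0 < product (map pred qs)
  product-pred-pos []       []        = s≤s z≤n
  product-pred-pos (q ∷ qs) (pq ∷ ps) = *-mono-≤ (pred-mono-≤ (prime>1 pq)) (product-pred-pos qs ps)

  -- For `z = 2 ^ y` the left side is at most `15 z³`. It bounds what Chebyshev's inequality at
  -- exponent `4 * y` would allow if primes were too scarce, against the true `z⁴`.
  count-gap : ∀ y z → 5 ≤ y → y ≤ z → 32 ≤ z → (4 * y + 2) * (2 * z * y + y) < z * z * z * z
  count-gap y z 5≤y y≤z 32≤z = ≤-<-trans (begin
    (4 * y + 2) * (2 * z * y + y)         ≤⟨ *-mono-≤ (+-monoʳ-≤ (4 * y) (≤-trans (m≤n+m 2 3) 5≤y))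
                                               (+-monoʳ-≤ (2 * z * y) (m≤n*m y z {{>-nonZero 0<z}})) ⟩
    (4 * y + y) * (2 * z * y + z * y)     ≡⟨ e y z ⟩
    15 * (z * (y * y))                    ≤⟨ *-monoʳ-≤ 15 (*-monoʳ-≤ z (*-mono-≤ y≤z y≤z)) ⟩
    15 * (z * (z * z))                    ∎)
    (<-≤-trans (*-monoˡ-< (z * (z * z)) {{>-nonZero (*-mono-≤ 0<z (*-mono-≤ 0<z 0<z))}} (≤-trans (m≤n+m 16 16) 32≤z))
      (≤-reflexive (e′ z)))
    where
    open ≤-Reasoning
    0<z : 0 < z
    0<z = ≤-trans (s≤s z≤n) 32≤z
    e : ∀ y z → (4 * y + y) * (2 * z * y + z * y) ≡ 15 * (z * (y * y))
    e = solve-∀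
    e′ : ∀ z → z * (z * (z * z)) ≡ z * z * z * z
    e′ = solve-∀

  -- Supplies the `2 ^ suc y * m` elements that the pigeonhole needs for the `y + 1` divisors 0,
  -- ..., `y`. With fewer primes above `M`, and at most `M + 1 ≤ y` others, `chebyshev` would
  -- contradict `count-gap`.
  many-primes : ∀ M y m → 5 ≤ y → suc M ≤ y → m ≤ y →
    2 ^ suc y * m ≤ length (filter (M <?_) (primes< (2 + (2 ^ (4 * y) + 2 ^ (4 * y)))))
  many-primes M y m 5≤y M<y m≤y with 2 ^ suc y * m ≤? length (filter (M <?_) (primes< (2 + (2 ^ (4 * y) + 2 ^ (4 * y)))))
  ... | yes p = p
  ... | no ¬p = contradiction (chebyshev w) (<⇒≱ (begin-strict
    (w + 2) * length (primes< t)         ≤⟨ *-monoʳ-≤ (w + 2)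
                                            (subst (λ t → length (primes< t) ≤ length (filter (M <?_) (primes< t)) + suc M)
                                              (m∸n+n≡m M<t) (length-primes<-split M (t ∸ suc M))) ⟩
    (w + 2) * (length (filter (M <?_) (primes< t)) + suc M)  ≤⟨ *-monoʳ-≤ (w + 2)
                                              (+-mono-≤ (≤-trans (<⇒≤ (≰⇒> ¬p)) (*-monoʳ-≤ (2 * z) m≤y)) M<y) ⟩
    (w + 2) * (2 * z * y + y)            <⟨ count-gap y z 5≤y (<⇒≤ (n<2^n y)) (^-monoʳ-≤ 2 5≤y) ⟩
    z * z * z * z                        ≡⟨ pow z ⟩
    z ^ 4                                ≡⟨ trans (^-*-assoc 2 y 4) (cong (2 ^_) (*-comm y 4)) ⟩
    2 ^ w                                ∎))
    where
    open ≤-Reasoning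
    w = 4 * y
    z = 2 ^ y
    t = 2 + (2 ^ w + 2 ^ w)
    pow : ∀ z → z * z * z * z ≡ z * (z * (z * (z * 1)))
    pow = solve-∀
    M<t : suc M ≤ t
    M<t = begin
      suc M           ≤⟨ M<y ⟩
      y               ≤⟨ m≤n*m y 4 ⟩
      4 * y           ≤⟨ <⇒≤ (n<2^n w) ⟩
      2 ^ w           ≤⟨ m≤m+n _ _ ⟩
      2 ^ w + 2 ^ w   ≤⟨ m≤n+m _ 2 ⟩
      t               ∎

  -- The square of `1 + 1/(3K)` is at most `1 + 1/K`, because `K ≤ 3K²`; it absorbs the two factors
  -- left by `σ*-close`.
  scale-down : ∀ K s B → 1 ≤ K → s * (3 * K * (3 * K)) ≤ B * (suc (3 * K) * suc (3 * K)) → s * K ≤ B * suc K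
  scale-down K s B 1≤K h = *-cancelʳ-≤ _ _ (3 * K * (3 * K)) {{>-nonZero (*-mono-≤ 0<3K 0<3K)}} (begin
    s * K * (3 * K * (3 * K))                 ≡⟨ e₁ s K (3 * K * (3 * K)) ⟩
    s * (3 * K * (3 * K)) * K                 ≤⟨ *-monoˡ-≤ K h ⟩
    B * (suc (3 * K) * suc (3 * K)) * K       ≡⟨ e₂ B K ⟩
    B * (9 * (K * K) * K + 6 * (K * K) + K * 1)
      ≤⟨ *-monoʳ-≤ B (+-monoʳ-≤ (9 * (K * K) * K + 6 * (K * K)) (*-monoʳ-≤ K (≤-trans 1≤K (m≤n*m K 3)))) ⟩
    B * (9 * (K * K) * K + 6 * (K * K) + K * (3 * K)) ≡⟨ e₃ B K ⟩
    B * suc K * (3 * K * (3 * K))             ∎)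
    where
    open ≤-Reasoning
    0<3K : 0 < 3 * K
    0<3K = ≤-trans 1≤K (m≤n*m K 3)
    e₁ : ∀ s K x → s * K * x ≡ s * x * K
    e₁ = solve-∀
    e₂ : ∀ B K → B * (suc (3 * K) * suc (3 * K)) * K ≡ B * (9 * (K * K) * K + 6 * (K * K) + K * 1)
    e₂ = solve-∀
    e₃ : ∀ B K → B * (9 * (K * K) * K + 6 * (K * K) + K * (3 * K)) ≡ B * suc K * (3 * K * (3 * K))
    e₃ = solve-∀

  -- A prime `p ≤ y` dividing `B` divides every `q - 1`, so its exponent is at least `L + 2`, and
  -- `p ^ L ≥ L + 1`. If `J` satisfies `y ^ J ≤ B` with `y = 2 ^ a`, then
  -- `a J ≤ (4y+2)(L+2) ≤ 5y(L+2)`, and the lower bound on `a` gives `J (L+1) ≤ y`.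
  σ*-homogeneous : ∀ L a n qs → 2 ^ a ≡ suc n → 2 ≤ suc n → 5 * ((2 + L) * suc L) ≤ a →
    length qs ≡ 2 + L → All Prime qs → All (_≤ 2 ^ (4 * suc n + 2)) qs →
    (∀ i → i < 2 + n → All (λ q → i ∣ pred q) qs ⊎ All (λ q → ¬ i ∣ pred q) qs) →
    σ* (product (map pred qs)) * (L * L) ≤ product (map pred qs) * (suc L * suc L)
  σ*-homogeneous L a n qs 2ᵃ≡y 2≤y a-large len primes bounded hom = σ*-close L n B 0<B small large
    where
    open ≤-Reasoning
    y = suc n
    m = 2 + L
    B = product (map pred qs)
    0<B : 0 < B
    0<B = product-pred-pos qs primes
    small : ∀ p → Prime p → p ≤ y → p ∣ B → suc L * (p * p) ≤ p ^ val p B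
    small p pp p≤y p∣B with hom p (s≤s p≤y)
    ... | inj₂ none = contradiction p∣B (∤product (map pred qs) pp (All.map⁺ none))
    ... | inj₁ all  = begin
      suc L * (p * p)     ≤⟨ *-monoˡ-≤ (p * p) (≤-trans (n<2^n L) (^-monoˡ-≤ L (prime>1 pp))) ⟩
      p ^ L * (p * p)     ≡⟨ e (p ^ L) p ⟩
      p ^ m               ≤⟨ ^-monoʳ-≤ p {{prime⇒nonZero pp}} (p^j∣⇒j≤val m pp 0<B
                               (subst (λ k → p ^ k ∣ B) (trans (length-map pred qs) len)
                                 (^length∣product (map pred qs) (All.map⁺ all)))) ⟩
      p ^ val p B         ∎
      where
      e : ∀ x p → x * (p * p) ≡ p * (p * x)
      e = solve-∀
    B≤ : B ≤ (2 ^ (4 * y + 2)) ^ m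
    B≤ = subst (λ k → B ≤ (2 ^ (4 * y + 2)) ^ k) (trans (length-map pred qs) len)
           (product≤^length (map pred qs) (All.map⁺ (All.map (≤-trans (pred[n]≤n)) bounded)))
    large : ∀ J → y ^ J ≤ B → J * suc L ≤ y
    large J yᴶ≤B = *-cancelʳ-≤ _ _ a {{>-nonZero (≤-trans (s≤s z≤n) a-large)}} (begin
      J * suc L * a                  ≡⟨ e₁ J (suc L) a ⟩
      a * J * suc L                  ≤⟨ *-monoˡ-≤ (suc L) (^-cancelʳ-≤ (a * J) ((4 * y + 2) * m) (begin
        2 ^ (a * J)                  ≡⟨ sym (^-*-assoc 2 a J) ⟩
        (2 ^ a) ^ J                  ≡⟨ cong (_^ J) 2ᵃ≡y ⟩
        y ^ J                        ≤⟨ yᴶ≤B ⟩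
        B                            ≤⟨ B≤ ⟩
        (2 ^ (4 * y + 2)) ^ m        ≡⟨ ^-*-assoc 2 (4 * y + 2) m ⟩
        2 ^ ((4 * y + 2) * m)        ∎)) ⟩
      (4 * y + 2) * m * suc L        ≤⟨ *-monoˡ-≤ (suc L) (*-monoˡ-≤ m (+-monoʳ-≤ (4 * y) 2≤y)) ⟩
      (4 * y + y) * m * suc L        ≡⟨ e₂ y m (suc L) ⟩
      y * (5 * (m * suc L))          ≤⟨ *-monoʳ-≤ y a-large ⟩
      y * a                          ∎)
      where
      e₁ : ∀ J l a → J * l * a ≡ a * J * l
      e₁ = solve-∀
      e₂ : ∀ y m l → (4 * y + y) * m * l ≡ y * (5 * (m * l))
      e₂ = solve-∀

  -- a and n are variables because Agda unfolds 2 ^ a exponentially when a begins with many sucs.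
  good-primes-at : ∀ K M a n → 1 ≤ K → 2 ^ a ≡ suc n → 5 * ((2 + 3 * K) * suc (3 * K)) ≤ a →
    5 ≤ suc n → M < suc n → 2 + 3 * K ≤ suc n →
    ∃[ qs ] (0 < length qs × Unique qs × All Prime qs × All (M <_) qs ×
             σ* (product (map pred qs)) * K ≤ product (map pred qs) * suc K)
  good-primes-at K M a n 1≤K 2ᵃ≡y a-large 5≤y M<y m≤y = truncate
    (homogeneous-sublist (λ i q → i ∣? pred q) (suc y) m
      (λ q → Prime q × M < q × q < b) (filter (M <?_) (primes< b))
      (Unique.filter⁺ (M <?_) (Unique.filter⁺ prime? (Unique.upTo⁺ b)))
      (All.zip (All.filter⁺ (M <?_) (All.all-filter prime? (upTo b)) ,
         All.zip (All.all-filter (M <?_) (primes< b) ,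
                  All.filter⁺ (M <?_) (All.filter⁺ prime? (All.all-upTo b)))))
      (many-primes M y m 5≤y M<y m≤y))
    where
    open ≤-Reasoning
    L = 3 * K
    m = 2 + L
    y = suc n
    w = 4 * y
    b = 2 + (2 ^ w + 2 ^ w)
    len : ∀ ys → m ≤ length ys → length (take m ys) ≡ m
    len ys m≤ = trans (length-take m ys) (m≤n⇒m⊓n≡m m≤)
    four : ∀ x → x + x + (x + x) ≡ x * 4
    four = solve-∀
    b≤ : b ≤ 2 ^ (w + 2)
    b≤ = begin
      1 + 1 + (2 ^ w + 2 ^ w)          ≤⟨ +-monoˡ-≤ (2 ^ w + 2 ^ w) (+-mono-≤ (^-pos w (s≤s z≤n)) (^-pos w (s≤s z≤n))) ⟩
      2 ^ w + 2 ^ w + (2 ^ w + 2 ^ w)  ≡⟨ four (2 ^ w) ⟩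
      2 ^ w * 4                        ≡⟨ sym (^-distribˡ-+-* 2 w 2) ⟩
      2 ^ (w + 2)                      ∎
    -- The list is cut to exactly `m` primes: the upper bound on the product of the `q - 1` depends
    -- on their number.
    truncate : ∃[ ys ] (Unique ys × All (λ q → Prime q × M < q × q < b) ys × m ≤ length ys ×
                        (∀ i → i < suc y → All (λ q → i ∣ pred q) ys ⊎ All (λ q → ¬ i ∣ pred q) ys)) →
      ∃[ qs ] (0 < length qs × Unique qs × All Prime qs × All (M <_) qs ×
               σ* (product (map pred qs)) * K ≤ product (map pred qs) * suc K)
    truncate (ys , uy , ry , m≤ , hom) =
        take m ys
      , ≤-trans (s≤s z≤n) (≤-reflexive (sym (len ys m≤)))
      , Unique.take⁺ m uy
      , All.map proj₁ (All.take⁺ m ry)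
      , All.map (proj₁ ∘ proj₂) (All.take⁺ m ry)
      , scale-down K (σ* (product (map pred (take m ys)))) (product (map pred (take m ys))) 1≤K
          (σ*-homogeneous L a n (take m ys) 2ᵃ≡y (≤-trans (m≤n+m 2 3) 5≤y)
          a-large (len ys m≤) (All.map proj₁ (All.take⁺ m ry))
          (All.map (λ r → ≤-trans (<⇒≤ (proj₂ (proj₂ r))) b≤) (All.take⁺ m ry))
          (λ i i< → Sum.map (All.take⁺ m) (All.take⁺ m) (hom i i<)))

  -- Passing through an existential keeps `a` and `n` opaque to its user.
  large-power : ∀ c → ∃[ a ] ∃[ n ] (2 ^ a ≡ suc n × c ≤ a × c ≤ n)
  large-power c = c , pred (2 ^ c) , sym (suc-pred (2 ^ c) {{>-nonZero (≤-trans (s≤s z≤n) (n<2^n c))}}) ,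
    ≤-refl , pred-mono-≤ (n<2^n c)

  good-primes : ∀ K M → 1 ≤ K →
    ∃[ qs ] (0 < length qs × Unique qs × All Prime qs × All (M <_) qs ×
             σ* (product (map pred qs)) * K ≤ product (map pred qs) * suc K)
  good-primes K M 1≤K
    -- The sum exceeds at once every threshold imposed on `a` and on `y = n + 1`.
    with a , n , 2ᵃ≡y , c≤a , c≤n ← large-power (5 * ((2 + 3 * K) * suc (3 * K)) + (M + 5))
    = good-primes-at K M a n 1≤K 2ᵃ≡y (≤-trans (m≤m+n c (M + 5)) c≤a)
        (m≤n⇒m≤1+n (≤-trans (≤-trans (m≤n+m 5 M) (m≤n+m (M + 5) c)) c≤n))
        (s≤s (≤-trans (≤-trans (m≤m+n M 5) (m≤n+m (M + 5) c)) c≤n))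
        (m≤n⇒m≤1+n (≤-trans (≤-trans (≤-trans (m≤m*n (2 + 3 * K) (suc (3 * K)))
          (m≤n*m ((2 + 3 * K) * suc (3 * K)) 5)) (m≤m+n c (M + 5))) c≤n))
    where
    c = 5 * ((2 + 3 * K) * suc (3 * K))

  -- Multiples of k

  prime∤product : ∀ {q} qs → Prime q → All Prime qs → All (q ≢_) qs → ¬ q ∣ product qs
  prime∤product qs pq ps ne = ∤product qs pq (All.zipWith (λ (pr , n) → n ∘ prime∣prime⇒≡ pq pr) (ps , ne))

  -- Each `q` exceeds `k` and differs from the remaining primes, so it does not divide the rest and
  -- `φ*-p*` splits it off.
  φ*-product-* : ∀ {k} qs → 0 < k → Unique qs → All Prime qs → All (k <_) qs →
    φ* (product qs * k) ≡ product (map pred qs) * φ* k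
  φ*-product-* {k} []       0<k []       []        []        = trans (cong φ* (*-identityˡ k)) (sym (*-identityˡ _))
  φ*-product-* {k} (q ∷ qs) 0<k (ne ∷ u) (pq ∷ ps) (k<q ∷ ls) = begin
    φ* (q * product qs * k)                    ≡⟨ cong φ* (*-assoc q (product qs) k) ⟩
    φ* (q * (product qs * k))                  ≡⟨ φ*-p* pq (*-mono-≤ (product-pos ps) 0<k) q∤ ⟩
    (q ∸ 1) * φ* (product qs * k)              ≡⟨ cong (pred q *_) (φ*-product-* qs 0<k u ps ls) ⟩
    pred q * (product (map pred qs) * φ* k)    ≡⟨ sym (*-assoc (pred q) _ _) ⟩
    pred q * product (map pred qs) * φ* k      ∎
    where
    open ≡-Reasoning
    q∤ : ¬ q ∣ product qs * k
    q∤ d = [ prime∤product qs pq ps ne , >⇒∤ {{>-nonZero 0<k}} k<q ]′ (euclidsLemma (product qs) k pq d)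

  -- Source of the strict inequality in `ratio-bound`.
  product-pred< : ∀ qs → 0 < length qs → All Prime qs → product (map pred qs) < product qs
  product-pred< (q ∷ qs) _ (pq ∷ ps) = ≤-<-trans (*-monoʳ-≤ (pred q) (product-pred≤ qs))
    (*-monoˡ-< (product qs) {{>-nonZero (product-pos ps)}} (≤-reflexive (suc-pred q {{prime⇒nonZero pq}})))
    where
    product-pred≤ : ∀ qs → product (map pred qs) ≤ product qs
    product-pred≤ []       = ≤-refl
    product-pred≤ (q ∷ qs) = *-mono-≤ (pred[n]≤n {q}) (product-pred≤ qs)

  <product : ∀ {M} qs → 0 < length qs → All Prime qs → All (M <_) qs → M < product qs
  <product (q ∷ qs) _ (pq ∷ ps) (M<q ∷ _) = ≤-trans M<q (m≤m*n q (product qs) {{>-nonZero (product-pos ps)}})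

  σ*-pos : ∀ {n} → 0 < n → 0 < σ* n
  σ*-pos {n} 0<n = subst (0 <_) (sym (σ*-Mult 0<n ≤-refl))
    (Π-pos (suc n) (λ i → onPrime-elim (0 <_) i (s≤s z≤n) (λ pi → σᵖ-pos i (val i n))))
    where
    σᵖ-pos : ∀ p e → 0 < σᵖ p e
    σᵖ-pos p zero    = s≤s z≤n
    σᵖ-pos p (suc e) = m≤n+m 1 _

  -- In fractions, `x / (P k) ≤ (s/k) (B/P) (1 + 1/(s b)) < s/k + 1/(k b) ≤ s/k + 1/b`.
  ratio-bound : ∀ {x s k b σB B P} → 0 < k → x ≤ σB * s → σB * (s * b) ≤ B * suc (s * b) → B < P →
    x * (k * b) < P * k * (s * b + k)
  ratio-bound {x} {s} {k} {b} {σB} {B} {P} 0<k x≤ close B<P = begin-strict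
    x * (k * b)                 ≤⟨ *-monoˡ-≤ (k * b) x≤ ⟩
    σB * s * (k * b)            ≡⟨ e₁ σB s k b ⟩
    σB * (s * b) * k            ≤⟨ *-monoˡ-≤ k close ⟩
    B * suc (s * b) * k         ≡⟨ *-assoc B (suc (s * b)) k ⟩
    B * (suc (s * b) * k)       <⟨ *-monoˡ-< (suc (s * b) * k) {{>-nonZero (*-mono-≤ (s≤s {0} {s * b} z≤n) 0<k)}} B<P ⟩
    P * (suc (s * b) * k)       ≡⟨ e₂ P (suc (s * b)) k ⟩
    P * k * (1 + s * b)         ≤⟨ *-monoʳ-≤ (P * k) (+-monoˡ-≤ (s * b) 0<k) ⟩
    P * k * (k + s * b)         ≡⟨ cong (P * k *_) (+-comm k (s * b)) ⟩
    P * k * (s * b + k)         ∎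
    where
    open ≤-Reasoning
    e₁ : ∀ x s k b → x * s * (k * b) ≡ x * (s * b) * k
    e₁ = solve-∀
    e₂ : ∀ x y z → x * (y * z) ≡ x * z * y
    e₂ = solve-∀

  -- The witness is `k` times a product of good primes. Precision `σ* (φ* k) * b` turns the relative
  -- error into an absolute one below `1/b`; primes above `N + k` make `n` exceed `N` and do not
  -- divide `k`.
  σ*φ*-near : ∀ k b N → 0 < k → 0 < b →
    ∃[ n ] (N < n × σ* (φ* n) * (k * b) < n * (σ* (φ* k) * b + k))
  σ*φ*-near k b N 0<k 0<b = multiple (good-primes (σ* (φ* k) * b) (N + k) (*-mono-≤ (σ*-pos (φ*-pos 0<k)) 0<b))
    where
    multiple : ∃[ qs ] (0 < length qs × Unique qs × All Prime qs × All (N + k <_) qs ×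
        σ* (product (map pred qs)) * (σ* (φ* k) * b) ≤ product (map pred qs) * suc (σ* (φ* k) * b)) →
      ∃[ n ] (N < n × σ* (φ* n) * (k * b) < n * (σ* (φ* k) * b + k))
    multiple (qs , 0<len , u , ps , ls , close) =
        product qs * k
      , ≤-<-trans (m≤m+n N k) (<-≤-trans (<product qs 0<len ps ls) (m≤m*n (product qs) k {{>-nonZero 0<k}}))
      , ratio-bound {σ* (φ* (product qs * k))} {σ* (φ* k)} {k} {b}
          {σ* (product (map pred qs))} {product (map pred qs)} {product qs} 0<k
          (subst (λ x → σ* x ≤ σ* (product (map pred qs)) * σ* (φ* k))
            (sym (φ*-product-* qs 0<k u ps (All.map (≤-<-trans (m≤n+m k N)) ls)))
            (σ*-submult (product (map pred qs)) (φ* k) (product-pred-pos qs ps) (φ*-pos 0<k)))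
          close (product-pred< qs 0<len ps)

  -- The value at twice the product of the Fermat primes.

  σ*-prime-power : ∀ {p n} e → Prime p → n ≡ p ^ suc e → σ* n ≡ p ^ suc e + 1
  σ*-prime-power {p} e pp refl = begin
    σ* (p ^ suc e)                ≡⟨ σ*-Mult (^-pos (suc e) 0<p) ≤-refl ⟩
    Mult σᵖ b (p ^ suc e)         ≡⟨ Π-update b p {p ^ suc e + 1} {g = λ _ → 1} elsewhere at-p p<b ⟩
    (p ^ suc e + 1) * Π b (λ _ → 1) ≡⟨ cong ((p ^ suc e + 1) *_) (Π≡1 b (λ _ → refl)) ⟩
    (p ^ suc e + 1) * 1           ≡⟨ *-identityʳ _ ⟩
    p ^ suc e + 1                 ∎
    where
    open ≡-Reasoning
    b = suc (p ^ suc e)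
    0<p = <⇒≤ (prime>1 pp)
    p<b : p < b
    p<b = s≤s (m≤m*n p (p ^ e) {{>-nonZero (^-pos e 0<p)}})
    val-power : ∀ {i} j → Prime i → i ≢ p → val i (p ^ j) ≡ 0
    val-power zero    pi i≢p = val-1 (prime>1 pi)
    val-power (suc j) pi i≢p = trans (val-≢-* pi pp i≢p (^-pos j 0<p)) (val-power j pi i≢p)
    elsewhere : ∀ i → i ≢ p → onPrime i (σᵖ i (val i (p ^ suc e))) ≡ 1
    elsewhere i i≢p = onPrime-elim (_≡ 1) i refl (λ pi → cong (σᵖ i) (val-power (suc e) pi i≢p))
    at-p : onPrime p (σᵖ p (val p (p ^ suc e))) ≡ (p ^ suc e + 1) * 1
    at-p = trans (onPrime-prime pp) (trans
      (cong (σᵖ p) (val-unique (suc e) (prime>1 pp) (^-pos (suc e) 0<p) (sym (*-identityʳ _)) (>⇒∤ (prime>1 pp))))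
      (sym (*-identityʳ _)))

  fermatPrimes : List ℕ
  fermatPrimes = 3 ∷ 5 ∷ 17 ∷ 257 ∷ 65537 ∷ []

  -- k stays a variable: comparing φ* at the literal 2 (2³² - 1) would make Agda evaluate it.
  φ*-product : ∀ {k} qs → k ≡ product qs * 1 → Unique qs → All Prime qs → φ* k ≡ product (map pred qs) * 1
  φ*-product {k} qs k≡ u ps = trans (trans (cong φ* k≡) (φ*-product-* {1} qs (s≤s z≤n) u ps (All.map prime>1 ps)))
    (cong (product (map pred qs) *_) φ*1≡1)
    where
    φ*1≡1 : φ* 1 ≡ 1
    φ*1≡1 = refl

  -- Here `k = 2 (2³² - 1)` is 2 times the five Fermat primes, so `φ* k` is 1·2·4·16·256·65536 =
  -- 2³¹. The prime-power formula then replaces evaluating `σ*`, which would enumerate all integers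
  -- up to 2³¹.
  σ*φ*-fermat : ∀ {k} → k ≡ 8589934590 → σ* (φ* k) ≡ 2147483649
  σ*φ*-fermat {k} k≡ = trans (σ*-prime-power {n = φ* k} 30 prime[2] (trans φ*k≡ 2³¹)) refl
    where
    φ*k≡ : φ* k ≡ 2147483648
    φ*k≡ = φ*-product (2 ∷ fermatPrimes) k≡ (from-yes (unique? (2 ∷ fermatPrimes))) (from-yes (All.all? prime? (2 ∷ fermatPrimes)))
    2³¹ : 2147483648 ≡ 2 ^ 31
    2³¹ = refl

-- Passage to rational numbers and the two bounds for the limit inferior.

open import Data.Nat using (ℕ; suc; z≤n; s≤s; _<_; _≤_; _^_; _/_)
import Data.Nat as ℕ
import Data.Nat.Properties as ℕ
open import Data.Nat.Divisibility using (_∣_; divides)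
open import Data.Nat.Coprimality using (Coprime)
open import Data.Nat.DivMod using (m*n/n≡m)
open import Data.Product using (_×_; ∃-syntax; _,_)
open import Relation.Binary.PropositionalEquality using (_≡_; _≢_; refl; sym; trans; cong; subst; subst₂)
open import Data.Integer using (+_; +[1+_]; +<+)
import Data.Integer as ℤ
import Data.Integer.Properties as ℤ
open import Data.Rational using (ℚ; mkℚ; _+_) renaming (_<_ to _<ℚ_; _/_ to _/ℚ_; 0ℚ to 0q)
import Data.Rational as ℚ
import Data.Rational.Properties as ℚ
import Data.Rational.Unnormalised as ℚᵘ
import Data.Rational.Unnormalised.Properties as ℚᵘ
open UnitaryDivisors using (σ*φ*-near; σ*φ*-fermat)

-- Clears denominators. Unnormalised rationals are used because `_/ℚ_` reduces its fraction to
-- lowest terms.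
/-<-/+ : ∀ x n s k a b .(c : Coprime (suc a) (suc b)) →
  x ℕ.* (suc k ℕ.* suc b) < suc n ℕ.* (s ℕ.* suc b ℕ.+ suc a ℕ.* suc k) →
  (+ x) /ℚ suc n <ℚ (+ s) /ℚ suc k + mkℚ +[1+ a ] b c
/-<-/+ x n s k a b c h = ℚ.toℚᵘ-cancel-<
  (ℚᵘ.<-respˡ-≃ (ℚᵘ.≃-sym (ℚ.toℚᵘ-fromℚᵘ (ℚᵘ.mkℚᵘ (+ x) n)))
  (ℚᵘ.<-respʳ-≃ (ℚᵘ.≃-sym (ℚᵘ.≃-trans (ℚ.toℚᵘ-homo-+ ((+ s) /ℚ suc k) (mkℚ +[1+ a ] b c))
                 (ℚᵘ.+-congˡ (ℚᵘ.mkℚᵘ +[1+ a ] b) (ℚ.toℚᵘ-fromℚᵘ (ℚᵘ.mkℚᵘ (+ s) k)))))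
  (ℚᵘ.*<* (subst₂ ℤ._<_ (ℤ.pos-* x (suc k ℕ.* suc b)) numerator (+<+ h)))))
  where
  numerator : + (suc n ℕ.* (s ℕ.* suc b ℕ.+ suc a ℕ.* suc k)) ≡
              ((+ s) ℤ.* (+ suc b) ℤ.+ +[1+ a ] ℤ.* (+ suc k)) ℤ.* (+ suc n)
  numerator = trans (ℤ.pos-* (suc n) _) (trans (ℤ.*-comm (+ suc n) _) (cong (ℤ._* (+ suc n))
    (trans (ℤ.pos-+ (s ℕ.* suc b) _) (cong (ℤ._+ +[1+ a ] ℤ.* (+ suc k)) (ℤ.pos-* s (suc b))))))

-- An upper bound for the limit inferior is expressed by values below it, up to any `δ > 0`, at
-- arbitrarily large `n`; every single ratio is such a bound.
liminf≤ratio : ∀ k (δ : ℚ) → 0q <ℚ δ → (N : ℕ) → ∃[ n ] (N < n × ratio n <ℚ ratio (suc k) + δ)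
liminf≤ratio k (mkℚ (+ 0)      b c) (ℚ.*<* (+<+ ())) N
liminf≤ratio k (mkℚ ℤ.-[1+ a ] b c) (ℚ.*<* ())       N
-- Since `δ = (a+1)/(b+1)` is at least `1/(b+1)`, precision `1/(b+1)` suffices.
liminf≤ratio k (mkℚ +[1+ a ]   b c) _ N = near⇒ratio-< (σ*φ*-near (suc k) (suc b) N (s≤s z≤n) (s≤s z≤n))
  where
  near⇒ratio-< : ∃[ n ] (N < n × σ* (φ* n) ℕ.* (suc k ℕ.* suc b) < n ℕ.* (σ* (φ* (suc k)) ℕ.* suc b ℕ.+ suc k)) →
    ∃[ n ] (N < n × ratio n <ℚ ratio (suc k) + mkℚ +[1+ a ] b c)
  near⇒ratio-< (suc n , N<n , near) = suc n , N<n , /-<-/+ (σ* (φ* (suc n))) n (σ* (φ* (suc k))) k a b c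
    (ℕ.≤-trans near (ℕ.*-monoʳ-≤ (suc n) (ℕ.+-monoʳ-≤ (σ* (φ* (suc k)) ℕ.* suc b) (ℕ.m≤m+n (suc k) (a ℕ.* suc k)))))

liminf≤quarter+ε : ∀ k → suc k ≡ 8589934590 → (δ : ℚ) → 0q <ℚ δ → (N : ℕ) →
  ∃[ n ] (N < n × ratio n <ℚ ((+ 1) /ℚ 4 + ε) + δ)
liminf≤quarter+ε k k≡ δ 0<δ N =
  subst (λ r → ∃[ n ] (N < n × ratio n <ℚ r + δ)) ratio≡ (liminf≤ratio k δ 0<δ N)
  where
  value : ∀ k s → suc k ≡ 8589934590 → s ≡ 2147483649 → (+ s) /ℚ suc k ≡ (+ 1) /ℚ 4 + ε
  -- Both sides reduce to the same fraction: `(2³¹ + 1) / (2 (2³² - 1)) = 1/4 + 3 / (4 (2³² - 1))`.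
  value _ _ refl refl = refl
  ratio≡ : ratio (suc k) ≡ (+ 1) /ℚ 4 + ε
  ratio≡ = value k (σ* (φ* (suc k))) k≡ (σ*φ*-fermat k≡)

theorem8 : ((m : ℕ) → 0 < m → 2 ∣ m → ((ℓ : ℕ) → 2 ≤ ℓ → m ≢ 2 ^ ℓ) →
    (δ : ℚ) → 0q <ℚ δ → (N : ℕ) → ∃[ n ] (N < n × ratio n <ℚ ratio (m / 2) + δ))
    × ((δ : ℚ) → 0q <ℚ δ → (N : ℕ) →
    ∃[ n ] (N < n × ratio n <ℚ ((+ 1) /ℚ 4 + ε) + δ))
theorem8 = liminf≤half , liminf≤quarter+ε 8589934589 refl
  where
  liminf≤half : (m : ℕ) → 0 < m → 2 ∣ m → ((ℓ : ℕ) → 2 ≤ ℓ → m ≢ 2 ^ ℓ) →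
    (δ : ℚ) → 0q <ℚ δ → (N : ℕ) → ∃[ n ] (N < n × ratio n <ℚ ratio (m / 2) + δ)
  liminf≤half .(suc k ℕ.* 2) 0<m (divides (suc k) refl) _ δ 0<δ N =
    subst (λ h → ∃[ n ] (N < n × ratio n <ℚ ratio h + δ)) (sym (m*n/n≡m (suc k) 2)) (liminf≤ratio k δ 0<δ N)
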